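{- Let $q$ be a prime power and $t\ge 2$. Assume there is a vector space partition of $V(2t,q)$ of type $(m_t,\ldots,m_1)$ with $m_t=q^t+1-a$. Let $1\le d<t$ be such that $m_d>0$. If \[ m_d<\frac{q^t-1}{q^{t-d}-1}, \] then $a\ge m_d-\mathrm{R}_q(t,d,m_d)$, where \[ \mathrm{R}_q(t,d,m):=m(m-1)\,\frac{\tfrac12(q^{2t-2d}-1)+1-q^{t-d}}{q^t-1-m(q^{t-d}-1)}. \]
   Context: A vector space partition of $V(n,q)$ (the $n$-dimensional vector space over $\mathrm{GF}(q)$) is a collection of subspaces, all of positive dimension, such that every nonzero vector lies in exactly one member. It has type $(m_t,\ldots,m_1)$ if it contains exactly $m_d$ subspaces of dimension $d$ for each $d\in\{1,\ldots,t\}$ and none of dimension larger than $t$. -}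

module Defs where

open import Level using (0ℓ)
open import Algebra.Bundles using (CommutativeRing)
open import Data.Nat as ℕ using (ℕ; zero; suc; _≤_; _^_)
open import Data.Nat.Primality using (Prime)
open import Data.Integer as ℤ using (ℤ; +_)
open import Data.Rational as ℚ using (ℚ; 0ℚ; 1ℚ; ½; _÷_; ≢-nonZero)
open import Data.Rational.Properties using () renaming (_≟_ to _≟ℚ_)
open import Data.Fin using (Fin)
open import Data.Vec using (Vec; []; _∷_; lookup; replicate; zipWith; map)
open import Data.List as List using (List; length; filter)
open import Data.List.Relation.Unary.All using (All)
open import Data.Product using (Σ; ∃; ∃-syntax; _×_; _,_)
open import Relation.Nullary using (¬_; yes; no)
open import Relation.Binary.PropositionalEquality using (_≡_)

IsPrimePower : ℕ → Set
IsPrimePower q = ∃[ p ] ∃[ k ] (Prime p × 1 ≤ k × q ≡ p ^ k)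

record FiniteField (q : ℕ) : Set₁ where
  field
    ring : CommutativeRing 0ℓ 0ℓ
  open CommutativeRing ring
  field
    0≉1     : ¬ (0# ≈ 1#)
    inverse : ∀ x → ¬ (x ≈ 0#) → ∃[ y ] (x * y ≈ 1#)
    enum    : Fin q → Carrier
    enum-injective  : ∀ i j → enum i ≈ enum j → i ≡ j
    enum-surjective : ∀ x → ∃[ i ] (enum i ≈ x)

module _ {q : ℕ} (F : FiniteField q) where
  open FiniteField F
  open CommutativeRing ring

  V : ℕ → Set
  V n = Vec Carrier n

  _≈ᵥ_ : ∀ {n} → V n → V n → Set
  u ≈ᵥ v = ∀ i → lookup u i ≈ lookup v i

  zeroV : ∀ n → V n
  zeroV n = replicate n 0#

  lincomb : ∀ {n d} → Vec Carrier d → Vec (V n) d → V n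
  lincomb {n} [] [] = zeroV n
  lincomb (c ∷ cs) (b ∷ bs) = zipWith _+_ (map (c *_) b) (lincomb cs bs)

  LinIndep : ∀ {n d} → Vec (V n) d → Set
  LinIndep {n} {d} bs = ∀ (cs : Vec Carrier d) → lincomb cs bs ≈ᵥ zeroV n → ∀ i → lookup cs i ≈ 0#

  record Subspace (n : ℕ) : Set where
    field
      dim   : ℕ
      basis : Vec (V n) dim
      indep : LinIndep basis
  open Subspace public

  _∈ₛ_ : ∀ {n} → V n → Subspace n → Set
  v ∈ₛ S = ∃[ cs ] (v ≈ᵥ lincomb cs (basis S))

  IsVSPartition : ∀ {n} → List (Subspace n) → Set
  IsVSPartition {n} P =
    All (λ S → 1 ≤ dim S) P ×
    (∀ (v : V n) → ¬ (v ≈ᵥ zeroV n) →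
      (∃[ i ] (v ∈ₛ List.lookup P i)) ×
      (∀ i j → v ∈ₛ List.lookup P i → v ∈ₛ List.lookup P j → i ≡ j))

  mult : ∀ {n} → List (Subspace n) → ℕ → ℕ
  mult P d = length (filter (λ S → dim S ℕ.≟ d) P)

fromℕ : ℕ → ℚ
fromℕ n = (+ n) ℚ./ 1

fromℤ : ℤ → ℚ
fromℤ z = z ℚ./ 1

-- total division on ℚ (x / 0 := 0); only used with nonzero denominators
_÷₀_ : ℚ → ℚ → ℚ
x ÷₀ y with y ≟ℚ 0ℚ
... | yes _ = 0ℚ
... | no y≢0 = _÷_ x y {{≢-nonZero y≢0}}

Rq : ℕ → ℕ → ℕ → ℕ → ℚ
Rq q t d m =
  (fromℕ m ℚ.* (fromℕ m ℚ.- 1ℚ)) ℚ.*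
  ((½ ℚ.* (fromℕ (q ^ (2 ℕ.* t ℕ.∸ 2 ℕ.* d)) ℚ.- 1ℚ) ℚ.+ 1ℚ ℚ.- fromℕ (q ^ (t ℕ.∸ d)))
   ÷₀ (fromℕ (q ^ t) ℚ.- 1ℚ ℚ.- fromℕ m ℚ.* (fromℕ (q ^ (t ℕ.∸ d)) ℚ.- 1ℚ)))

{-# OPTIONS --safe #-}

-- For a vector h let y(h) be the number of members of P of dimension t or d that are annihilated by
-- the functional h ∙_.  As y(h) is an integer, (y(h) - 1)(y(h) - 2) ≥ 0, and the theorem is the sum
-- of this inequality over all h ≠ 0.  The two moments of y are explicit: independent vectors
-- b₁, …, bₖ have q^(2t - k) annihilating functionals, and the bases of two distinct members of P are
-- jointly independent.  Writing N = q^t, Q = q^(t - d) and Y = mₜ + m_d Q, one gets Σ y = N Y and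
-- Σ y² = Y² + N Y - (mₜ + m_d Q²), while y(0) = mₜ + m_d.

module Submission where

open import Defs
open import Algebra.Bundles using (CommutativeRing)
open import Data.Bool using (if_then_else_)
open import Data.Fin as Fin using (Fin; zero; suc)
open import Data.List as List using (List; []; _∷_; _++_; allFin; concatMap)
open import Data.List.Membership.Propositional.Properties using (∈-lookup)
import Data.List.Properties as List
open import Data.List.Relation.Unary.All as All using (All)
open import Data.Nat as ℕ using (ℕ; zero; suc)
import Data.Nat.Properties as ℕ
open import Data.Product using (_,_; proj₂)
open import Data.Vec as Vec using (Vec; []; _∷_)
import Data.Vec.Properties as Vec
open import Data.Vec.Relation.Unary.All as Allᵥ using ([]; _∷_)
import Data.Vec.Relation.Unary.All.Properties as Allᵥ
open import Function using (_∘_; id)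
open import Relation.Nullary using (¬_; Dec; yes; no; does; contradiction)
open import Relation.Nullary.Decidable using (map′; _×-dec_)
open import Relation.Binary.PropositionalEquality using (_≡_; _≢_; refl; sym; trans; cong; cong₂; subst; subst₂; module ≡-Reasoning)

-- The constants 1 and 2 are the integers around the mean of y. Put m = m_d. If a = m, the mean over
-- h ≠ 0 exceeds 1 by m N (Q - 1) / (N² - 1), which is less than 1 when m (Q - 1) < N - 1. This is
-- the assumption on m_d, cleared of its denominator; it says that D = N - 1 - m (Q - 1), the
-- denominator of R, is positive. The zero functional has to be left out because of the unknown a.
-- With mₜ = N + 1 - a, both Y² and y(0)² contain a², and removing the term at h = 0 makes these
-- squares cancel. What remains is linear in a with coefficient 2 D, so dividing by 2 D gives the
-- bound. In dimension 2t, two distinct members of dimensions k and l have q^(2t - k - l) common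
-- annihilating functionals. This is q^(t - k) times q^(t - l), so the pairs sum to the square of Y,
-- up to a correction on the diagonal.

-- Finite sums of integers and indicator functions

module Summation where

  open import Data.Integer using (ℤ; _+_; _*_; 0ℤ; 1ℤ; _≤_; +≤+) renaming (+_ to pos)
  open import Data.Integer.Properties
  open import Data.Integer.Tactic.RingSolver using (solve-∀)

  private variable A B : Set

  ∑ : List A → (A → ℤ) → ℤ
  ∑ []       f = 0ℤ
  ∑ (x ∷ xs) f = f x + ∑ xs f

  infixr 5 ∑
  syntax ∑ xs (λ x → e) = ∑[ x ∈ xs ] e

  ∑-cong : ∀ (xs : List A) {f g} → (∀ x → f x ≡ g x) → ∑ xs f ≡ ∑ xs g
  ∑-cong []       f≗g = refl
  ∑-cong (x ∷ xs) f≗g = cong₂ _+_ (f≗g x) (∑-cong xs f≗g)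

  ∑-0 : ∀ (xs : List A) → (∑[ x ∈ xs ] 0ℤ) ≡ 0ℤ
  ∑-0 []       = refl
  ∑-0 (x ∷ xs) = trans (+-identityˡ _) (∑-0 xs)

  ∑-+ : ∀ (xs : List A) f g → (∑[ x ∈ xs ] f x + g x) ≡ ∑ xs f + ∑ xs g
  ∑-+ []       f g = refl
  ∑-+ (x ∷ xs) f g = trans (cong ((f x + g x) +_) (∑-+ xs f g)) (interchange (f x) (g x) (∑ xs f) (∑ xs g))
    where
    interchange : ∀ a b c d → (a + b) + (c + d) ≡ (a + c) + (b + d)
    interchange = solve-∀

  ∑-*ˡ : ∀ (xs : List A) c f → (∑[ x ∈ xs ] c * f x) ≡ c * ∑ xs f
  ∑-*ˡ []       c f = sym (*-zeroʳ c)
  ∑-*ˡ (x ∷ xs) c f = trans (cong (c * f x +_) (∑-*ˡ xs c f)) (sym (*-distribˡ-+ c (f x) (∑ xs f)))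

  ∑-*ʳ : ∀ (xs : List A) f c → (∑[ x ∈ xs ] f x * c) ≡ ∑ xs f * c
  ∑-*ʳ xs f c = trans (∑-cong xs λ x → *-comm (f x) c) (trans (∑-*ˡ xs c f) (*-comm c (∑ xs f)))

  ∑-swap : ∀ (xs : List A) (ys : List B) (f : A → B → ℤ) →
           (∑[ x ∈ xs ] ∑[ y ∈ ys ] f x y) ≡ (∑[ y ∈ ys ] ∑[ x ∈ xs ] f x y)
  ∑-swap []       ys f = sym (∑-0 ys)
  ∑-swap (x ∷ xs) ys f = trans (cong (∑ ys (f x) +_) (∑-swap xs ys f)) (sym (∑-+ ys (f x) _))

  ∑-*-∑ : ∀ (xs : List A) (ys : List B) f g → ∑ xs f * ∑ ys g ≡ (∑[ x ∈ xs ] ∑[ y ∈ ys ] f x * g y)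
  ∑-*-∑ xs ys f g = trans (sym (∑-*ʳ xs f (∑ ys g))) (∑-cong xs λ x → sym (∑-*ˡ ys (f x) g))

  ∑-nonneg : ∀ (xs : List A) {f} → (∀ x → 0ℤ ≤ f x) → 0ℤ ≤ ∑ xs f
  ∑-nonneg []       0≤f = +≤+ ℕ.z≤n
  ∑-nonneg (x ∷ xs) 0≤f = +-mono-≤ (0≤f x) (∑-nonneg xs 0≤f)

  ∑-++ : ∀ (xs ys : List A) f → ∑ (xs ++ ys) f ≡ ∑ xs f + ∑ ys f
  ∑-++ []       ys f = sym (+-identityˡ _)
  ∑-++ (x ∷ xs) ys f = trans (cong (f x +_) (∑-++ xs ys f)) (sym (+-assoc (f x) _ _))

  ∑-map : ∀ (g : A → B) xs f → ∑ (List.map g xs) f ≡ ∑ xs (f ∘ g)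
  ∑-map g []       f = refl
  ∑-map g (x ∷ xs) f = cong (f (g x) +_) (∑-map g xs f)

  ∑-concatMap : ∀ (g : A → List B) xs f → ∑ (concatMap g xs) f ≡ (∑[ x ∈ xs ] ∑ (g x) f)
  ∑-concatMap g []       f = refl
  ∑-concatMap g (x ∷ xs) f = trans (∑-++ (g x) (concatMap g xs) f) (cong (∑ (g x) f +_) (∑-concatMap g xs f))

  ∑-allFin-suc : ∀ n f → ∑ (allFin (suc n)) f ≡ f zero + ∑ (allFin n) (f ∘ suc)
  ∑-allFin-suc n f = cong (f zero +_)
    (trans (cong (λ xs → ∑ xs f) (sym (List.map-tabulate id suc))) (∑-map suc (allFin n) f))

  ∑-lookup : ∀ (xs : List A) f → ∑ (allFin (List.length xs)) (f ∘ List.lookup xs) ≡ ∑ xs f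
  ∑-lookup xs f = trans (sym (∑-map (List.lookup xs) (allFin _) f))
    (cong (λ ys → ∑ ys f) (trans (List.map-tabulate id (List.lookup xs)) (List.tabulate-lookup xs)))

  -- Only the boolean of the decision matters. Hence the indicator of `suc i Fin.≟ suc j` computes
  -- to that of `i Fin.≟ j`, which drives the induction in `∑-δ`.
  𝟙 : Dec A → ℤ
  𝟙 a? = if does a? then 1ℤ else 0ℤ

  𝟙-yes : (a? : Dec A) → A → 𝟙 a? ≡ 1ℤ
  𝟙-yes (yes _) a = refl
  𝟙-yes (no ¬a) a = contradiction a ¬a

  𝟙-no : (a? : Dec A) → ¬ A → 𝟙 a? ≡ 0ℤ
  𝟙-no (yes a) ¬a = contradiction a ¬a
  𝟙-no (no _)  ¬a = refl

  𝟙-cong : (a? : Dec A) (b? : Dec B) → (A → B) → (B → A) → 𝟙 a? ≡ 𝟙 b?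
  𝟙-cong (yes a) b? f g = sym (𝟙-yes b? (f a))
  𝟙-cong (no ¬a) b? f g = sym (𝟙-no b? (¬a ∘ g))

  𝟙-× : (a? : Dec A) (b? : Dec B) → 𝟙 a? * 𝟙 b? ≡ 𝟙 (a? ×-dec b?)
  𝟙-× (yes _) (yes _) = refl
  𝟙-× (yes _) (no _)  = refl
  𝟙-× (no _)  b?      = *-zeroˡ (𝟙 b?)

  𝟙-idem : (a? : Dec A) → 𝟙 a? * 𝟙 a? ≡ 𝟙 a?
  𝟙-idem (yes _) = refl
  𝟙-idem (no _)  = refl

  -- Where the condition fails both products vanish, so the other factor may be rewritten under the
  -- condition. This later turns `g (dim S)` into the constant `g t` or `g d`.
  𝟙-*-cong : (a? : Dec A) {x y : ℤ} → (A → x ≡ y) → 𝟙 a? * x ≡ 𝟙 a? * y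
  𝟙-*-cong (yes a) x≡y = cong (1ℤ *_) (x≡y a)
  𝟙-*-cong (no _)  x≡y = refl

  ∑-𝟙-filter : ∀ {P : A → Set} (P? : ∀ x → Dec (P x)) xs → ∑ xs (𝟙 ∘ P?) ≡ pos (List.length (List.filter P? xs))
  ∑-𝟙-filter P? []       = refl
  ∑-𝟙-filter P? (x ∷ xs) with P? x
  ... | yes _ = cong (1ℤ +_) (∑-𝟙-filter P? xs)
  ... | no _  = trans (+-identityˡ _) (∑-𝟙-filter P? xs)

  ∑-δ : ∀ {n} (i : Fin n) (f : Fin n → ℤ) → (∑[ j ∈ allFin n ] 𝟙 (i Fin.≟ j) * f j) ≡ f i
  ∑-δ {suc n} zero f = begin
    (∑[ j ∈ allFin (suc n) ] 𝟙 (zero Fin.≟ j) * f j) ≡⟨ ∑-allFin-suc n (λ j → 𝟙 (zero Fin.≟ j) * f j) ⟩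
    1ℤ * f zero + (∑[ j ∈ allFin n ] 0ℤ)             ≡⟨ cong₂ _+_ (*-identityˡ (f zero)) (∑-0 (allFin n)) ⟩
    f zero + 0ℤ                                      ≡⟨ +-identityʳ _ ⟩
    f zero                                           ∎
    where open ≡-Reasoning
  ∑-δ {suc n} (suc i) f = begin
    (∑[ j ∈ allFin (suc n) ] 𝟙 (suc i Fin.≟ j) * f j) ≡⟨ ∑-allFin-suc n (λ j → 𝟙 (suc i Fin.≟ j) * f j) ⟩
    0ℤ + (∑[ j ∈ allFin n ] 𝟙 (i Fin.≟ j) * f (suc j)) ≡⟨ +-identityˡ _ ⟩
    (∑[ j ∈ allFin n ] 𝟙 (i Fin.≟ j) * f (suc j))     ≡⟨ ∑-δ i (f ∘ suc) ⟩
    f (suc i)                                         ∎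
    where open ≡-Reasoning

  ∑-1-allFin : ∀ n → (∑[ i ∈ allFin n ] 1ℤ) ≡ pos n
  ∑-1-allFin zero    = refl
  ∑-1-allFin (suc n) = trans (∑-allFin-suc n (λ _ → 1ℤ)) (cong (1ℤ +_) (∑-1-allFin n))

  ∑-affine : ∀ (xs : List A) c e f → (∑[ x ∈ xs ] c * (1ℤ + e * f x)) ≡ c * ((∑[ x ∈ xs ] 1ℤ) + e * ∑ xs f)
  ∑-affine xs c e f = trans (∑-*ˡ xs c _) (cong (c *_) (trans (∑-+ xs _ _) (cong ((∑[ x ∈ xs ] 1ℤ) +_) (∑-*ˡ xs e f))))

-- Linear algebra and counting over a finite field

module LinearAlgebra {q : ℕ} (F : FiniteField q) where

  open FiniteField F
  open CommutativeRing ring using (Carrier; _≈_; 0#; 1#; setoid; reflexive) renaming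
    ( _+_ to _⊕_; _*_ to _⊗_; -_ to ⊖_; refl to ≈-refl; sym to ≈-sym; trans to ≈-trans
    ; +-cong to ⊕-cong; +-congˡ to ⊕-congˡ; +-congʳ to ⊕-congʳ; *-congˡ to ⊗-congˡ; *-congʳ to ⊗-congʳ
    ; +-assoc to ⊕-assoc; +-comm to ⊕-comm; +-identityˡ to ⊕-identityˡ; +-identityʳ to ⊕-identityʳ
    ; *-assoc to ⊗-assoc; *-comm to ⊗-comm; *-identityʳ to ⊗-identityʳ
    ; zeroˡ to ⊗-zeroˡ; zeroʳ to ⊗-zeroʳ; distribˡ to ⊗-distribˡ-⊕
    ; -‿inverseˡ to ⊖-inverseˡ; -‿cong to ⊖-cong; ring to ring′
    ; +-commutativeSemigroup to ⊕-commutativeSemigroup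
    ; *-commutativeSemigroup to ⊗-commutativeSemigroup; +-abelianGroup to ⊕-abelianGroup )
  open import Algebra.Properties.Ring ring′ using (-‿distribˡ-*)
  open import Algebra.Properties.AbelianGroup ⊕-abelianGroup using (inverseʳ-unique; ⁻¹-∙-comm; ε⁻¹≈ε)
  open import Algebra.Properties.CommutativeSemigroup ⊕-commutativeSemigroup using (interchange; x∙yz≈y∙xz)
  open import Algebra.Properties.CommutativeSemigroup ⊗-commutativeSemigroup using () renaming (x∙yz≈y∙xz to x⊗yz≈y⊗xz)
  open import Relation.Binary.Reasoning.Setoid setoid
  open import Data.Integer using (ℤ; _+_; _*_; _-_; 0ℤ; 1ℤ; ≢-nonZero) renaming (+_ to pos)
  open import Data.Integer.Properties
  open import Data.Integer.Tactic.RingSolver using (solve-∀)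
  open Summation

  1<q : 1 ℕ.< q
  1<q with enum-surjective 0# | enum-surjective 1#
  ... | i , i≈0 | j , j≈1 = distinct⇒1< i j λ where refl → 0≉1 (≈-trans (≈-sym i≈0) j≈1)
    where
    distinct⇒1< : ∀ {n} (i j : Fin n) → i ≢ j → 1 ℕ.< n
    distinct⇒1< {1}             zero zero i≢j = contradiction refl i≢j
    distinct⇒1< {suc (suc n)}   i    j    i≢j = ℕ.s≤s (ℕ.s≤s ℕ.z≤n)

  infix 4 _≈?_
  -- The equality of the field is an arbitrary equivalence; it is decided by comparing indices in
  -- the enumeration.
  _≈?_ : ∀ x y → Dec (x ≈ y)
  x ≈? y with enum-surjective x | enum-surjective y
  ... | i , i≈x | j , j≈y = map′
    (λ where refl → ≈-trans (≈-sym i≈x) j≈y)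
    (λ x≈y → enum-injective i j (≈-trans i≈x (≈-trans x≈y (≈-sym j≈y))))
    (i Fin.≟ j)

  IsZero : ∀ {n} → V F n → Set
  IsZero = Allᵥ.All (_≈ 0#)

  isZero? : ∀ {n} (v : V F n) → Dec (IsZero v)
  isZero? = Allᵥ.all? (_≈? 0#)

  IsZero⇒≈ᵥ0 : ∀ {n} {v : V F n} → IsZero v → _≈ᵥ_ F v (zeroV F n)
  IsZero⇒≈ᵥ0 (x≈0 ∷ v≈0) zero    = x≈0
  IsZero⇒≈ᵥ0 (x≈0 ∷ v≈0) (suc i) = IsZero⇒≈ᵥ0 v≈0 i

  ≈ᵥ0⇒IsZero : ∀ {n} {v : V F n} → _≈ᵥ_ F v (zeroV F n) → IsZero v
  ≈ᵥ0⇒IsZero {v = []}    v≈0 = []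
  ≈ᵥ0⇒IsZero {v = x ∷ v} v≈0 = v≈0 zero ∷ ≈ᵥ0⇒IsZero (v≈0 ∘ suc)

  -- The bilinear form and linear combinations

  infix 8 _∙_
  _∙_ : ∀ {n} → V F n → V F n → Carrier
  []      ∙ []      = 0#
  (x ∷ u) ∙ (y ∷ v) = x ⊗ y ⊕ u ∙ v

  ∙-zeroˡ : ∀ {n} {u : V F n} → IsZero u → ∀ v → u ∙ v ≈ 0#
  ∙-zeroˡ []          []      = ≈-refl
  ∙-zeroˡ (x≈0 ∷ u≈0) (y ∷ v) =
    ≈-trans (⊕-cong (≈-trans (⊗-congʳ x≈0) (⊗-zeroˡ y)) (∙-zeroˡ u≈0 v)) (⊕-identityˡ 0#)

  ∙-comm : ∀ {n} (u v : V F n) → u ∙ v ≈ v ∙ u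
  ∙-comm []      []      = ≈-refl
  ∙-comm (x ∷ u) (y ∷ v) = ⊕-cong (⊗-comm x y) (∙-comm u v)

  ∙-zeroʳ : ∀ {n} (u : V F n) {v} → IsZero v → u ∙ v ≈ 0#
  ∙-zeroʳ u {v} v≈0 = ≈-trans (∙-comm u v) (∙-zeroˡ v≈0 u)

  ∙-negˡ : ∀ {n} (u v : V F n) → Vec.map ⊖_ u ∙ v ≈ ⊖ (u ∙ v)
  ∙-negˡ []      []      = ≈-sym ε⁻¹≈ε
  ∙-negˡ (x ∷ u) (y ∷ v) =
    ≈-trans (⊕-cong (≈-sym (-‿distribˡ-* x y)) (∙-negˡ u v)) (⁻¹-∙-comm (x ⊗ y) (u ∙ v))

  ∙-++ : ∀ {m n} (u u′ : V F m) (v v′ : V F n) → (u Vec.++ v) ∙ (u′ Vec.++ v′) ≈ u ∙ u′ ⊕ v ∙ v′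
  ∙-++ []      []        v v′ = ≈-sym (⊕-identityˡ _)
  ∙-++ (x ∷ u) (y ∷ u′) v v′ = ≈-trans (⊕-congˡ (∙-++ u u′ v v′)) (≈-sym (⊕-assoc _ _ _))

  ∙-+-* : ∀ {n} (h b v : V F n) c →
          h ∙ Vec.zipWith _⊕_ (Vec.map (c ⊗_) b) v ≈ c ⊗ h ∙ b ⊕ h ∙ v
  ∙-+-* []      []      []      c = ≈-sym (≈-trans (⊕-identityʳ _) (⊗-zeroʳ c))
  ∙-+-* (x ∷ h) (y ∷ b) (z ∷ v) c = begin
    x ⊗ (c ⊗ y ⊕ z) ⊕ h ∙ _                          ≈⟨ ⊕-cong (⊗-distribˡ-⊕ x _ z) (∙-+-* h b v c) ⟩
    (x ⊗ (c ⊗ y) ⊕ x ⊗ z) ⊕ (c ⊗ h ∙ b ⊕ h ∙ v)     ≈⟨ ⊕-congʳ (⊕-congʳ (x⊗yz≈y⊗xz x c y)) ⟩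
    (c ⊗ (x ⊗ y) ⊕ x ⊗ z) ⊕ (c ⊗ h ∙ b ⊕ h ∙ v)     ≈⟨ interchange _ _ _ _ ⟩
    (c ⊗ (x ⊗ y) ⊕ c ⊗ h ∙ b) ⊕ (x ⊗ z ⊕ h ∙ v)     ≈⟨ ⊕-congʳ (⊗-distribˡ-⊕ c _ _) ⟨
    c ⊗ (x ⊗ y ⊕ h ∙ b) ⊕ (x ⊗ z ⊕ h ∙ v)            ∎

  -- The symmetry behind the double count: the same scalar is a functional `h` applied to a
  -- combination, and a functional `c` applied to the vector of values of `h` on `bs`.
  ∙-lincomb : ∀ {n k} (h : V F n) (c : V F k) (bs : Vec (V F n) k) →
              h ∙ lincomb F c bs ≈ c ∙ Vec.map (h ∙_) bs
  ∙-lincomb h []      []       = ∙-zeroʳ h (≈ᵥ0⇒IsZero (λ _ → ≈-refl))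
  ∙-lincomb h (c ∷ cs) (b ∷ bs) =
    ≈-trans (∙-+-* h b (lincomb F cs bs) c) (⊕-congˡ (∙-lincomb h cs bs))

  lookup-lincomb : ∀ {n k} (c : V F k) (bs : Vec (V F n) k) i →
                   Vec.lookup (lincomb F c bs) i ≈ c ∙ Vec.map (λ b → Vec.lookup b i) bs
  lookup-lincomb []       []       i = reflexive (Vec.lookup-replicate i 0#)
  lookup-lincomb (c ∷ cs) (b ∷ bs) i = begin
    Vec.lookup (Vec.zipWith _⊕_ (Vec.map (c ⊗_) b) (lincomb F cs bs)) i
      ≡⟨ Vec.lookup-zipWith _⊕_ i (Vec.map (c ⊗_) b) (lincomb F cs bs) ⟩
    Vec.lookup (Vec.map (c ⊗_) b) i ⊕ Vec.lookup (lincomb F cs bs) i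
      ≈⟨ ⊕-cong (reflexive (Vec.lookup-map i (c ⊗_) b)) (lookup-lincomb cs bs i) ⟩
    c ⊗ Vec.lookup b i ⊕ cs ∙ Vec.map (λ b → Vec.lookup b i) bs ∎

  -- A vanishing combination splits as u + v = 0 with u in the first span and v in the second. Then
  -- u = - v lies in both spans, so u = 0 by the last hypothesis, hence v = 0, and each family
  -- contributes zero coefficients.
  LinIndep-++ : ∀ {n k l} (bs : Vec (V F n) k) (bs′ : Vec (V F n) l) →
    LinIndep F bs → LinIndep F bs′ →
    (∀ c c′ → _≈ᵥ_ F (lincomb F c bs) (lincomb F c′ bs′) → _≈ᵥ_ F (lincomb F c bs) (zeroV F n)) →
    LinIndep F (bs Vec.++ bs′)
  LinIndep-++ {n} {k} {l} bs bs′ indep indep′ disjoint cs cs≈0 with Vec.splitAt k cs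
  ... | c , c′ , refl = Allᵥ.lookup⁺ {P = _≈ 0#} {xs = c Vec.++ c′}
    (Allᵥ.++⁺ {xs = c} {ys = c′} (Allᵥ.lookup⁻ (indep c u≈0)) (Allᵥ.lookup⁻ (indep′ c′ v≈0)))
    where
    coord : Fin n → V F n → Carrier
    coord i b = Vec.lookup b i

    sum≈0 : ∀ i → coord i (lincomb F c bs) ⊕ coord i (lincomb F c′ bs′) ≈ 0#
    sum≈0 i = begin
      coord i (lincomb F c bs) ⊕ coord i (lincomb F c′ bs′)
        ≈⟨ ⊕-cong (lookup-lincomb c bs i) (lookup-lincomb c′ bs′ i) ⟩
      c ∙ Vec.map (coord i) bs ⊕ c′ ∙ Vec.map (coord i) bs′
        ≈⟨ ∙-++ c _ c′ _ ⟨
      (c Vec.++ c′) ∙ (Vec.map (coord i) bs Vec.++ Vec.map (coord i) bs′)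
        ≡⟨ cong ((c Vec.++ c′) ∙_) (Vec.map-++ (coord i) bs bs′) ⟨
      (c Vec.++ c′) ∙ Vec.map (coord i) (bs Vec.++ bs′)
        ≈⟨ lookup-lincomb (c Vec.++ c′) (bs Vec.++ bs′) i ⟨
      coord i (lincomb F (c Vec.++ c′) (bs Vec.++ bs′))
        ≈⟨ cs≈0 i ⟩
      coord i (zeroV F n)
        ≡⟨ Vec.lookup-replicate i 0# ⟩
      0# ∎

    u≈-v : _≈ᵥ_ F (lincomb F c bs) (lincomb F (Vec.map ⊖_ c′) bs′)
    u≈-v i = begin
      coord i (lincomb F c bs)                    ≈⟨ inverseʳ-unique _ _ (≈-trans (⊕-comm _ _) (sum≈0 i)) ⟩
      ⊖ coord i (lincomb F c′ bs′)                ≈⟨ ⊖-cong (lookup-lincomb c′ bs′ i) ⟩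
      ⊖ (c′ ∙ Vec.map (coord i) bs′)              ≈⟨ ∙-negˡ c′ _ ⟨
      Vec.map ⊖_ c′ ∙ Vec.map (coord i) bs′       ≈⟨ lookup-lincomb (Vec.map ⊖_ c′) bs′ i ⟨
      coord i (lincomb F (Vec.map ⊖_ c′) bs′)     ∎

    u≈0 : _≈ᵥ_ F (lincomb F c bs) (zeroV F n)
    u≈0 = disjoint c (Vec.map ⊖_ c′) u≈-v

    v≈0 : _≈ᵥ_ F (lincomb F c′ bs′) (zeroV F n)
    v≈0 i = begin
      coord i (lincomb F c′ bs′)                              ≈⟨ ⊕-identityˡ _ ⟨
      0# ⊕ coord i (lincomb F c′ bs′)                         ≡⟨ cong (_⊕ coord i (lincomb F c′ bs′)) (Vec.lookup-replicate i 0#) ⟨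
      coord i (zeroV F n) ⊕ coord i (lincomb F c′ bs′)        ≈⟨ ⊕-congʳ (u≈0 i) ⟨
      coord i (lincomb F c bs) ⊕ coord i (lincomb F c′ bs′)   ≈⟨ sum≈0 i ⟩
      0#                                                      ≡⟨ Vec.lookup-replicate i 0# ⟨
      coord i (zeroV F n)                                     ∎

  -- Enumeration of the field and of its coordinate spaces

  elements : List Carrier
  elements = List.map enum (allFin q)

  -- One representative of each class of `_≈ᵥ_`: all coordinates are values of `enum`.
  vectors : ∀ n → List (V F n)
  vectors zero    = [] ∷ []
  vectors (suc n) = concatMap (λ a → List.map (a ∷_) (vectors n)) elements

  ∑-1-elements : (∑[ a ∈ elements ] 1ℤ) ≡ pos q
  ∑-1-elements = trans (∑-map enum (allFin q) (λ _ → 1ℤ)) (∑-1-allFin q)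

  ∑-const-elements : ∀ c → (∑[ a ∈ elements ] c) ≡ pos q * c
  ∑-const-elements c = trans (∑-cong elements λ _ → sym (*-identityˡ c))
    (trans (∑-*ʳ elements (λ _ → 1ℤ) c) (cong (_* c) ∑-1-elements))

  ∑-elements-unique : ∀ {P : Carrier → Set} (P? : ∀ a → Dec (P a)) z →
    (∀ a → P a → a ≈ z) → (∀ a → a ≈ z → P a) → (∑[ a ∈ elements ] 𝟙 (P? a)) ≡ 1ℤ
  ∑-elements-unique P? z P⇒≈ ≈⇒P with enum-surjective z
  ... | i , i≈z = trans (∑-map enum (allFin q) (𝟙 ∘ P?)) (trans (∑-cong (allFin q) δ) (∑-δ i (λ _ → 1ℤ)))
    where
    δ : ∀ j → 𝟙 (P? (enum j)) ≡ 𝟙 (i Fin.≟ j) * 1ℤ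
    δ j = trans
      (𝟙-cong (P? (enum j)) (i Fin.≟ j)
        (λ p → enum-injective i j (≈-trans i≈z (≈-sym (P⇒≈ (enum j) p))))
        (λ where refl → ≈⇒P (enum j) i≈z))
      (sym (*-identityʳ _))

  ∑-vectors-suc : ∀ n f → ∑ (vectors (suc n)) f ≡ (∑[ a ∈ elements ] ∑[ v ∈ vectors n ] f (a ∷ v))
  ∑-vectors-suc n f = trans (∑-concatMap _ elements f) (∑-cong elements λ a → ∑-map (a ∷_) (vectors n) f)

  ∑-1-vectors : ∀ n → (∑[ v ∈ vectors n ] 1ℤ) ≡ pos (q ℕ.^ n)
  ∑-1-vectors zero    = refl
  ∑-1-vectors (suc n) = trans (∑-vectors-suc n (λ _ → 1ℤ))
    (trans (∑-cong elements λ _ → ∑-1-vectors n)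
    (trans (∑-const-elements (pos (q ℕ.^ n))) (sym (pos-* q (q ℕ.^ n)))))

  ∑-isZero : ∀ n → (∑[ v ∈ vectors n ] 𝟙 (isZero? v)) ≡ 1ℤ
  ∑-isZero zero    = refl
  ∑-isZero (suc n) = trans (∑-vectors-suc n (𝟙 ∘ isZero?))
    (trans (∑-cong elements inner) (∑-elements-unique (_≈? 0#) 0# (λ _ → id) (λ _ → id)))
    where
    inner : ∀ a → (∑[ v ∈ vectors n ] 𝟙 (isZero? (a ∷ v))) ≡ 𝟙 (a ≈? 0#)
    inner a = trans
      (∑-cong (vectors n) λ v → trans
        (𝟙-cong (isZero? (a ∷ v)) ((a ≈? 0#) ×-dec isZero? v) Allᵥ.uncons (λ (x , y) → x ∷ y))
        (sym (𝟙-× (a ≈? 0#) (isZero? v))))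
      (trans (∑-*ˡ (vectors n) (𝟙 (a ≈? 0#)) (𝟙 ∘ isZero?))
      (trans (cong (𝟙 (a ≈? 0#) *_) (∑-isZero n)) (*-identityʳ _)))

  -- The expression is `c ⊕ h ∙ (x ∷ v)` with first coordinate `a` of `h` and remainder `r`. A
  -- nonzero `x` acts as a pivot: the other coordinates of `h` are free and determine `a`.
  affine-root-unique : ∀ c x r → ¬ x ≈ 0# → (∑[ a ∈ elements ] 𝟙 (c ⊕ (a ⊗ x ⊕ r) ≈? 0#)) ≡ 1ℤ
  affine-root-unique c x r x≉0 with inverse x x≉0
  ... | x⁻¹ , xx⁻¹≈1 = ∑-elements-unique (λ a → c ⊕ (a ⊗ x ⊕ r) ≈? 0#) (⊖ (c ⊕ r) ⊗ x⁻¹) to from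
    where
    to : ∀ a → c ⊕ (a ⊗ x ⊕ r) ≈ 0# → a ≈ ⊖ (c ⊕ r) ⊗ x⁻¹
    to a eq = begin
      a                     ≈⟨ ⊗-identityʳ a ⟨
      a ⊗ 1#                ≈⟨ ⊗-congˡ xx⁻¹≈1 ⟨
      a ⊗ (x ⊗ x⁻¹)         ≈⟨ ⊗-assoc a x x⁻¹ ⟨
      a ⊗ x ⊗ x⁻¹           ≈⟨ ⊗-congʳ (inverseʳ-unique (c ⊕ r) (a ⊗ x) (begin
        (c ⊕ r) ⊕ a ⊗ x       ≈⟨ ⊕-assoc c r _ ⟩
        c ⊕ (r ⊕ a ⊗ x)       ≈⟨ ⊕-congˡ (⊕-comm r _) ⟩
        c ⊕ (a ⊗ x ⊕ r)       ≈⟨ eq ⟩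
        0#                    ∎)) ⟩
      ⊖ (c ⊕ r) ⊗ x⁻¹       ∎

    from : ∀ a → a ≈ ⊖ (c ⊕ r) ⊗ x⁻¹ → c ⊕ (a ⊗ x ⊕ r) ≈ 0#
    from a eq = begin
      c ⊕ (a ⊗ x ⊕ r)       ≈⟨ x∙yz≈y∙xz c (a ⊗ x) r ⟩
      a ⊗ x ⊕ (c ⊕ r)       ≈⟨ ⊕-congʳ (begin
        a ⊗ x                     ≈⟨ ⊗-congʳ eq ⟩
        ⊖ (c ⊕ r) ⊗ x⁻¹ ⊗ x       ≈⟨ ⊗-assoc _ x⁻¹ x ⟩
        ⊖ (c ⊕ r) ⊗ (x⁻¹ ⊗ x)     ≈⟨ ⊗-congˡ (≈-trans (⊗-comm x⁻¹ x) xx⁻¹≈1) ⟩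
        ⊖ (c ⊕ r) ⊗ 1#            ≈⟨ ⊗-identityʳ _ ⟩
        ⊖ (c ⊕ r)                 ∎) ⟩
      ⊖ (c ⊕ r) ⊕ (c ⊕ r)   ≈⟨ ⊖-inverseˡ (c ⊕ r) ⟩
      0#                    ∎

  -- The shift by c makes the induction on n go through when the first coordinate of v vanishes.
  ∑-affine-hyperplane : ∀ {n} c (v : V F n) → ¬ IsZero v →
    pos q * (∑[ h ∈ vectors n ] 𝟙 (c ⊕ h ∙ v ≈? 0#)) ≡ pos (q ℕ.^ n)
  ∑-affine-hyperplane c [] v≉0 = contradiction [] v≉0
  ∑-affine-hyperplane {suc n} c (x ∷ v) xv≉0 with x ≈? 0#
  ... | no x≉0 = R.begin
    pos q * (∑[ h ∈ vectors (suc n) ] 𝟙 (c ⊕ h ∙ (x ∷ v) ≈? 0#))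
      R.≡⟨ cong (pos q *_) (∑-vectors-suc n _) ⟩
    pos q * (∑[ a ∈ elements ] ∑[ h ∈ vectors n ] 𝟙 (c ⊕ (a ⊗ x ⊕ h ∙ v) ≈? 0#))
      R.≡⟨ cong (pos q *_) (∑-swap elements (vectors n) _) ⟩
    pos q * (∑[ h ∈ vectors n ] ∑[ a ∈ elements ] 𝟙 (c ⊕ (a ⊗ x ⊕ h ∙ v) ≈? 0#))
      R.≡⟨ cong (pos q *_) (∑-cong (vectors n) λ h → affine-root-unique c x (h ∙ v) x≉0) ⟩
    pos q * (∑[ h ∈ vectors n ] 1ℤ)
      R.≡⟨ cong (pos q *_) (∑-1-vectors n) ⟩
    pos q * pos (q ℕ.^ n)
      R.≡⟨ pos-* q (q ℕ.^ n) ⟨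
    pos (q ℕ.^ suc n) R.∎
    where module R = ≡-Reasoning
  ... | yes x≈0 = R.begin
    pos q * (∑[ h ∈ vectors (suc n) ] 𝟙 (c ⊕ h ∙ (x ∷ v) ≈? 0#))
      R.≡⟨ cong (pos q *_) (∑-vectors-suc n _) ⟩
    pos q * (∑[ a ∈ elements ] ∑[ h ∈ vectors n ] 𝟙 (c ⊕ (a ⊗ x ⊕ h ∙ v) ≈? 0#))
      R.≡⟨ ∑-*ˡ elements (pos q) _ ⟨
    (∑[ a ∈ elements ] pos q * (∑[ h ∈ vectors n ] 𝟙 (c ⊕ (a ⊗ x ⊕ h ∙ v) ≈? 0#)))
      R.≡⟨ ∑-cong elements (λ a → cong (pos q *_) (∑-cong (vectors n) λ h →
             𝟙-cong (c ⊕ (a ⊗ x ⊕ h ∙ v) ≈? 0#) ((c ⊕ a ⊗ x) ⊕ h ∙ v ≈? 0#)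
               (≈-trans (⊕-assoc c _ _)) (≈-trans (≈-sym (⊕-assoc c _ _))))) ⟩
    (∑[ a ∈ elements ] pos q * (∑[ h ∈ vectors n ] 𝟙 ((c ⊕ a ⊗ x) ⊕ h ∙ v ≈? 0#)))
      R.≡⟨ ∑-cong elements (λ a → ∑-affine-hyperplane (c ⊕ a ⊗ x) v (λ v≈0 → xv≉0 (x≈0 ∷ v≈0))) ⟩
    (∑[ a ∈ elements ] pos (q ℕ.^ n))
      R.≡⟨ ∑-const-elements _ ⟩
    pos q * pos (q ℕ.^ n)
      R.≡⟨ pos-* q (q ℕ.^ n) ⟨
    pos (q ℕ.^ suc n) R.∎
    where module R = ≡-Reasoning

  -- Orthogonality and the size of annihilators

  q-1 : ℤ
  q-1 = pos (q ℕ.∸ 1)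

  1+[q-1]≡q : 1ℤ + q-1 ≡ pos q
  1+[q-1]≡q = cong pos (ℕ.m+[n∸m]≡n (ℕ.<⇒≤ 1<q))

  -- An elementary form of the orthogonality of additive characters: a hyperplane has q^n / q
  -- vectors, the whole space q times as many. The factor `pos q` on the left avoids the exponent n
  -- - 1, and the indicator merges both cases into one expression that can be summed over `v`.
  ∑-orthogonal : ∀ {n} (v : V F n) →
    pos q * (∑[ h ∈ vectors n ] 𝟙 (h ∙ v ≈? 0#)) ≡ pos (q ℕ.^ n) * (1ℤ + q-1 * 𝟙 (isZero? v))
  ∑-orthogonal {n} v with isZero? v
  ... | no v≉0 = R.begin
    pos q * (∑[ h ∈ vectors n ] 𝟙 (h ∙ v ≈? 0#))
      R.≡⟨ cong (pos q *_) (∑-cong (vectors n) λ h → 𝟙-cong (h ∙ v ≈? 0#) (0# ⊕ h ∙ v ≈? 0#)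
             (≈-trans (⊕-identityˡ _)) (≈-trans (≈-sym (⊕-identityˡ _)))) ⟩
    pos q * (∑[ h ∈ vectors n ] 𝟙 (0# ⊕ h ∙ v ≈? 0#))
      R.≡⟨ ∑-affine-hyperplane 0# v v≉0 ⟩
    pos (q ℕ.^ n)
      R.≡⟨ *-identityʳ _ ⟨
    pos (q ℕ.^ n) * (1ℤ + 0ℤ)
      R.≡⟨ cong (λ z → pos (q ℕ.^ n) * (1ℤ + z)) (*-zeroʳ q-1) ⟨
    pos (q ℕ.^ n) * (1ℤ + q-1 * 0ℤ) R.∎
    where module R = ≡-Reasoning
  ... | yes v≈0 = R.begin
    pos q * (∑[ h ∈ vectors n ] 𝟙 (h ∙ v ≈? 0#))
      R.≡⟨ cong (pos q *_) (∑-cong (vectors n) λ h → 𝟙-yes (h ∙ v ≈? 0#) (∙-zeroʳ h v≈0)) ⟩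
    pos q * (∑[ h ∈ vectors n ] 1ℤ)
      R.≡⟨ cong (pos q *_) (∑-1-vectors n) ⟩
    pos q * pos (q ℕ.^ n)
      R.≡⟨ *-comm (pos q) _ ⟩
    pos (q ℕ.^ n) * pos q
      R.≡⟨ cong (pos (q ℕ.^ n) *_) 1+[q-1]≡q ⟨
    pos (q ℕ.^ n) * (1ℤ + q-1)
      R.≡⟨ cong (λ z → pos (q ℕ.^ n) * (1ℤ + z)) (*-identityʳ q-1) ⟨
    pos (q ℕ.^ n) * (1ℤ + q-1 * 1ℤ) R.∎
    where module R = ≡-Reasoning

  -- Phrased as the vanishing of the vector of values, so that the indicator in `∑-orthogonal`,
  -- taken at this vector, is the annihilation indicator by definition.
  Annihilates : ∀ {n k} → V F n → Vec (V F n) k → Set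
  Annihilates h bs = IsZero (Vec.map (h ∙_) bs)

  annihilates? : ∀ {n k} (h : V F n) (bs : Vec (V F n) k) → Dec (Annihilates h bs)
  annihilates? h bs = isZero? (Vec.map (h ∙_) bs)

  isZero⇒annihilates : ∀ {n k} {h : V F n} → IsZero h → (bs : Vec (V F n) k) → Annihilates h bs
  isZero⇒annihilates h≈0 bs = Allᵥ.map⁺ (Allᵥ.universal (∙-zeroˡ h≈0) bs)

  -- Reduces the count for a pair of members to the count for a single family, to which
  -- `annihilator-card` applies.
  annihilates-++ : ∀ {n k l} (h : V F n) (bs : Vec (V F n) k) (bs′ : Vec (V F n) l) →
    𝟙 (annihilates? h bs) * 𝟙 (annihilates? h bs′) ≡ 𝟙 (annihilates? h (bs Vec.++ bs′))
  annihilates-++ h bs bs′ = trans (𝟙-× (annihilates? h bs) (annihilates? h bs′))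
    (𝟙-cong (annihilates? h bs ×-dec annihilates? h bs′) (annihilates? h (bs Vec.++ bs′))
      (λ (x , y) → subst IsZero (sym (Vec.map-++ (h ∙_) bs bs′)) (Allᵥ.++⁺ x y))
      (λ z → Allᵥ.++⁻ (Vec.map (h ∙_) bs) (subst IsZero (Vec.map-++ (h ∙_) bs bs′) z)))

  -- Double counting of the pairs (h , c) with h ∙ lincomb c bs = 0.
  annihilator-card : ∀ {n k} (bs : Vec (V F n) k) → LinIndep F bs →
    pos (q ℕ.^ k) * (∑[ h ∈ vectors n ] 𝟙 (annihilates? h bs)) ≡ pos (q ℕ.^ n)
  annihilator-card {n} {k} bs indep = *-cancelˡ-≡ q-1 (K * A) N {{≢-nonZero q-1≢0}} (R.begin
    -- The two evaluations of q X share the summand K N. Once it is removed, a common factor q - 1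
    -- is left, nonzero because q > 1.
    q-1 * (K * A)                 R.≡⟨ solve₁ q-1 K A N ⟩
    K * (N + q-1 * A) - K * N     R.≡⟨ cong (_- K * N) (trans (sym by-h) by-c) ⟩
    N * (K + q-1 * 1ℤ) - K * N    R.≡⟨ solve₂ q-1 K N ⟩
    q-1 * N                       R.∎)
    where
    module R = ≡-Reasoning
    K = pos (q ℕ.^ k)
    N = pos (q ℕ.^ n)
    A = ∑[ h ∈ vectors n ] 𝟙 (annihilates? h bs)
    X = ∑[ h ∈ vectors n ] ∑[ c ∈ vectors k ] 𝟙 (h ∙ lincomb F c bs ≈? 0#)

    q-1≢0 : q-1 ≢ 0ℤ
    q-1≢0 q-1≡0 = ℕ.m>n⇒m∸n≢0 1<q (+-injective q-1≡0)

    solve₁ : ∀ e K A N → e * (K * A) ≡ K * (N + e * A) - K * N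
    solve₁ = solve-∀

    solve₂ : ∀ e K N → N * (K + e * 1ℤ) - K * N ≡ e * N
    solve₂ = solve-∀

    by-h : pos q * X ≡ K * (N + q-1 * A)
    by-h = R.begin
      pos q * X
        R.≡⟨ ∑-*ˡ (vectors n) (pos q) _ ⟨
      (∑[ h ∈ vectors n ] pos q * (∑[ c ∈ vectors k ] 𝟙 (h ∙ lincomb F c bs ≈? 0#)))
        R.≡⟨ ∑-cong (vectors n) (λ h → cong (pos q *_) (∑-cong (vectors k) λ c →
               𝟙-cong (h ∙ lincomb F c bs ≈? 0#) (c ∙ Vec.map (h ∙_) bs ≈? 0#)
                 (≈-trans (≈-sym (∙-lincomb h c bs))) (≈-trans (∙-lincomb h c bs)))) ⟩
      (∑[ h ∈ vectors n ] pos q * (∑[ c ∈ vectors k ] 𝟙 (c ∙ Vec.map (h ∙_) bs ≈? 0#)))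
        R.≡⟨ ∑-cong (vectors n) (λ h → ∑-orthogonal (Vec.map (h ∙_) bs)) ⟩
      (∑[ h ∈ vectors n ] K * (1ℤ + q-1 * 𝟙 (annihilates? h bs)))
        R.≡⟨ ∑-affine (vectors n) K q-1 _ ⟩
      K * ((∑[ h ∈ vectors n ] 1ℤ) + q-1 * A)
        R.≡⟨ cong (λ z → K * (z + q-1 * A)) (∑-1-vectors n) ⟩
      K * (N + q-1 * A) R.∎

    by-c : pos q * X ≡ N * (K + q-1 * 1ℤ)
    by-c = R.begin
      pos q * X
        R.≡⟨ cong (pos q *_) (∑-swap (vectors n) (vectors k) _) ⟩
      pos q * (∑[ c ∈ vectors k ] ∑[ h ∈ vectors n ] 𝟙 (h ∙ lincomb F c bs ≈? 0#))
        R.≡⟨ ∑-*ˡ (vectors k) (pos q) _ ⟨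
      (∑[ c ∈ vectors k ] pos q * (∑[ h ∈ vectors n ] 𝟙 (h ∙ lincomb F c bs ≈? 0#)))
        R.≡⟨ ∑-cong (vectors k) (λ c → ∑-orthogonal (lincomb F c bs)) ⟩
      (∑[ c ∈ vectors k ] N * (1ℤ + q-1 * 𝟙 (isZero? (lincomb F c bs))))
        -- Independence enters here: the combination vanishes only for zero coefficients, so a
        -- single `c` contributes the extra term.
        R.≡⟨ ∑-cong (vectors k) (λ c → cong (λ z → N * (1ℤ + q-1 * z))
               (𝟙-cong (isZero? (lincomb F c bs)) (isZero? c)
                 (λ z → Allᵥ.lookup⁻ (indep c (IsZero⇒≈ᵥ0 z)))
                 (λ c≈0 → ≈ᵥ0⇒IsZero λ i → ≈-trans (lookup-lincomb c bs i)
                   (≈-trans (∙-zeroˡ c≈0 _) (reflexive (sym (Vec.lookup-replicate i 0#))))))) ⟩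
      (∑[ c ∈ vectors k ] N * (1ℤ + q-1 * 𝟙 (isZero? c)))
        R.≡⟨ ∑-affine (vectors k) N q-1 _ ⟩
      N * ((∑[ c ∈ vectors k ] 1ℤ) + q-1 * (∑[ c ∈ vectors k ] 𝟙 (isZero? c)))
        R.≡⟨ cong₂ (λ y z → N * (y + q-1 * z)) (∑-1-vectors k) (∑-isZero k) ⟩
      N * (K + q-1 * 1ℤ) R.∎

-- Moments of the number of annihilated members

module SecondMoment {q : ℕ} (F : FiniteField q) (t : ℕ) (P : List (Subspace F (2 ℕ.* t)))
  (partition : IsVSPartition F P) (dim≤t : All (λ S → dim S ℕ.≤ t) P) where

  open import Data.Integer using (ℤ; _+_; _*_; _-_; -_; 0ℤ; 1ℤ; _≤_; +≤+) renaming (+_ to pos; -[1+_] to neg)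
  open import Data.Integer.Properties
  open import Data.Integer.Tactic.RingSolver using (solve-∀)
  open Summation
  open LinearAlgebra F
  open ≡-Reasoning

  private
    n = 2 ℕ.* t
    I = allFin (List.length P)
    U = List.lookup P

  δ : Fin (List.length P) → ℕ
  δ i = dim (U i)

  N : ℤ
  N = pos (q ℕ.^ t)

  -- For k ≤ t, a k-dimensional subspace has q^(2t - k) annihilating functionals, that is, `N` times
  -- this number.
  codim-card : ℕ → ℤ
  codim-card k = pos (q ℕ.^ (t ℕ.∸ k))

  f : Fin (List.length P) → ℤ
  f i = codim-card (δ i)

  δ≤t : ∀ i → δ i ℕ.≤ t
  δ≤t i = All.lookup dim≤t (∈-lookup i)

  N≡q^k*codim-card : ∀ {k} → k ℕ.≤ t → N ≡ pos (q ℕ.^ k) * codim-card k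
  N≡q^k*codim-card {k} k≤t = begin
    pos (q ℕ.^ t)                          ≡⟨ cong (λ m → pos (q ℕ.^ m)) (ℕ.m+[n∸m]≡n k≤t) ⟨
    pos (q ℕ.^ (k ℕ.+ (t ℕ.∸ k)))          ≡⟨ cong pos (ℕ.^-distribˡ-+-* q k (t ℕ.∸ k)) ⟩
    pos (q ℕ.^ k ℕ.* q ℕ.^ (t ℕ.∸ k))      ≡⟨ pos-* (q ℕ.^ k) _ ⟩
    pos (q ℕ.^ k) * codim-card k           ∎

  q^n≡N*N : pos (q ℕ.^ n) ≡ N * N
  q^n≡N*N = begin
    pos (q ℕ.^ (t ℕ.+ (t ℕ.+ 0)))   ≡⟨ cong (λ m → pos (q ℕ.^ (t ℕ.+ m))) (ℕ.+-identityʳ t) ⟩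
    pos (q ℕ.^ (t ℕ.+ t))           ≡⟨ cong pos (ℕ.^-distribˡ-+-* q t t) ⟩
    pos (q ℕ.^ t ℕ.* q ℕ.^ t)       ≡⟨ pos-* (q ℕ.^ t) _ ⟩
    N * N                           ∎

  q^-cancelˡ : ∀ k {x y} → pos (q ℕ.^ k) * x ≡ pos (q ℕ.^ k) * y → x ≡ y
  q^-cancelˡ k {x} {y} = *-cancelˡ-≡ (pos (q ℕ.^ k)) x y {{ℕ.m^n≢0 q k {{ℕ.>-nonZero (ℕ.<⇒≤ 1<q)}}}}

  α : Fin (List.length P) → V F n → ℤ
  α i h = 𝟙 (annihilates? h (basis (U i)))

  ∑-α : ∀ i → (∑[ h ∈ vectors n ] α i h) ≡ N * f i
  ∑-α i = q^-cancelˡ (δ i) (begin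
    pos (q ℕ.^ δ i) * (∑[ h ∈ vectors n ] α i h)   ≡⟨ annihilator-card (basis (U i)) (indep (U i)) ⟩
    pos (q ℕ.^ n)                                  ≡⟨ q^n≡N*N ⟩
    N * N                                          ≡⟨ cong (N *_) (N≡q^k*codim-card (δ≤t i)) ⟩
    N * (pos (q ℕ.^ δ i) * f i)                    ≡⟨ rearrange N (pos (q ℕ.^ δ i)) (f i) ⟩
    pos (q ℕ.^ δ i) * (N * f i)                    ∎)
    where
    rearrange : ∀ a b c → a * (b * c) ≡ b * (a * c)
    rearrange = solve-∀

  distinct-indep : ∀ i j → i ≢ j → LinIndep F (basis (U i) Vec.++ basis (U j))
  distinct-indep i j i≢j = LinIndep-++ (basis (U i)) (basis (U j)) (indep (U i)) (indep (U j)) disjoint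
    where
    open CommutativeRing (FiniteField.ring F) using () renaming (refl to ≈-refl)
    disjoint : ∀ c c′ → _≈ᵥ_ F (lincomb F c (basis (U i))) (lincomb F c′ (basis (U j))) →
               _≈ᵥ_ F (lincomb F c (basis (U i))) (zeroV F n)
    -- Uniqueness in the partition concerns nonzero vectors only; a nonzero common vector would
    -- force i = j.
    disjoint c c′ u≈v with isZero? (lincomb F c (basis (U i)))
    ... | yes u≈0 = IsZero⇒≈ᵥ0 u≈0
    ... | no  u≉0 = contradiction
      (proj₂ (proj₂ partition (lincomb F c (basis (U i))) (u≉0 ∘ ≈ᵥ0⇒IsZero)) i j (c , λ _ → ≈-refl) (c′ , u≈v)) i≢j

  -- For distinct members the count is N * N divided by both cardinalities, which is the product
  -- `f i * f j`. On the diagonal it is `N * f i`. Writing this as the product plus a correction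
  -- lets the double sum factor into a square, while `∑-δ` collects the corrections.
  ∑-α*α : ∀ i j → (∑[ h ∈ vectors n ] α i h * α j h) ≡ f i * f j + 𝟙 (i Fin.≟ j) * (N * f j - f j * f j)
  ∑-α*α i j with i Fin.≟ j
  ... | yes refl = begin
    (∑[ h ∈ vectors n ] α i h * α i h)         ≡⟨ ∑-cong (vectors n) (λ h → 𝟙-idem (annihilates? h (basis (U i)))) ⟩
    (∑[ h ∈ vectors n ] α i h)                 ≡⟨ ∑-α i ⟩
    N * f i                                    ≡⟨ rearrange N (f i) ⟩
    f i * f i + 1ℤ * (N * f i - f i * f i)     ∎
    where
    rearrange : ∀ a b → a * b ≡ b * b + 1ℤ * (a * b - b * b)
    rearrange = solve-∀
  ... | no i≢j = trans (q^-cancelˡ (δ i ℕ.+ δ j) (begin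
    pos (q ℕ.^ (δ i ℕ.+ δ j)) * (∑[ h ∈ vectors n ] α i h * α j h)
      ≡⟨ cong (pos (q ℕ.^ (δ i ℕ.+ δ j)) *_) (∑-cong (vectors n) λ h → annihilates-++ h (basis (U i)) (basis (U j))) ⟩
    pos (q ℕ.^ (δ i ℕ.+ δ j)) * (∑[ h ∈ vectors n ] 𝟙 (annihilates? h (basis (U i) Vec.++ basis (U j))))
      ≡⟨ annihilator-card _ (distinct-indep i j i≢j) ⟩
    pos (q ℕ.^ n)
      ≡⟨ q^n≡N*N ⟩
    N * N
      ≡⟨ cong₂ _*_ (N≡q^k*codim-card (δ≤t i)) (N≡q^k*codim-card (δ≤t j)) ⟩
    (pos (q ℕ.^ δ i) * f i) * (pos (q ℕ.^ δ j) * f j)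
      ≡⟨ rearrange (pos (q ℕ.^ δ i)) (f i) (pos (q ℕ.^ δ j)) (f j) ⟩
    (pos (q ℕ.^ δ i) * pos (q ℕ.^ δ j)) * (f i * f j)
      ≡⟨ cong (_* (f i * f j)) (trans (cong pos (ℕ.^-distribˡ-+-* q (δ i) (δ j))) (pos-* (q ℕ.^ δ i) _)) ⟨
    pos (q ℕ.^ (δ i ℕ.+ δ j)) * (f i * f j) ∎)) (sym (trans (cong (f i * f j +_) (*-zeroˡ (N * f j - f j * f j))) (+-identityʳ _)))
    where
    rearrange : ∀ a b c d → (a * b) * (c * d) ≡ (a * c) * (b * d)
    rearrange = solve-∀

  -- No integer lies strictly between 1 and 2, so the two factors never have opposite signs.
  [y-1][y-2]≥0 : ∀ y → 0ℤ ≤ y * y - pos 3 * y + pos 2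
  [y-1][y-2]≥0 y = subst (0ℤ ≤_) (factor y) (nonneg y)
    where
    factor : ∀ y → (y - 1ℤ) * (y - pos 2) ≡ y * y - pos 3 * y + pos 2
    factor = solve-∀

    nonneg : ∀ y → 0ℤ ≤ (y - 1ℤ) * (y - pos 2)
    nonneg (pos 0)             = +≤+ ℕ.z≤n
    nonneg (pos 1)             = +≤+ ℕ.z≤n
    nonneg (pos (suc (suc m))) = subst (0ℤ ≤_) (pos-* (suc m) m) (+≤+ ℕ.z≤n)
    nonneg (neg m)             = +≤+ ℕ.z≤n

  -- An idempotent integer is 0 or 1, so `w` selects members by dimension. Idempotence removes the
  -- square of the weight on the diagonal of the second moment.
  module Weighted (w : ℕ → ℤ) (w-idem : ∀ k → w k * w k ≡ w k) where

    y : V F n → ℤ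
    y h = ∑[ i ∈ I ] w (δ i) * α i h

    -- The factor `1ℤ` in `y₀` gives all three sums the form of a weight times a function of the
    -- dimension, so that `∑-weighted` evaluates each of them.
    Y Z y₀ : ℤ
    Y  = ∑[ S ∈ P ] w (dim S) * codim-card (dim S)
    Z  = ∑[ S ∈ P ] w (dim S) * (codim-card (dim S) * codim-card (dim S))
    y₀ = ∑[ S ∈ P ] w (dim S) * 1ℤ

    Y-indexed : (∑[ i ∈ I ] w (δ i) * f i) ≡ Y
    Y-indexed = ∑-lookup P (λ S → w (dim S) * codim-card (dim S))

    first-moment : ∑ (vectors n) y ≡ N * Y
    first-moment = begin
      (∑[ h ∈ vectors n ] ∑[ i ∈ I ] w (δ i) * α i h)   ≡⟨ ∑-swap (vectors n) I _ ⟩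
      (∑[ i ∈ I ] ∑[ h ∈ vectors n ] w (δ i) * α i h)   ≡⟨ ∑-cong I (λ i → ∑-*ˡ (vectors n) (w (δ i)) (α i)) ⟩
      (∑[ i ∈ I ] w (δ i) * ∑ (vectors n) (α i))        ≡⟨ ∑-cong I (λ i → trans (cong (w (δ i) *_) (∑-α i)) (rearrange (w (δ i)) N (f i))) ⟩
      (∑[ i ∈ I ] N * (w (δ i) * f i))                  ≡⟨ ∑-*ˡ I N _ ⟩
      N * (∑[ i ∈ I ] w (δ i) * f i)                    ≡⟨ cong (N *_) Y-indexed ⟩
      N * Y                                             ∎
      where
      rearrange : ∀ a b c → a * (b * c) ≡ b * (a * c)
      rearrange = solve-∀

    second-moment : (∑[ h ∈ vectors n ] y h * y h) ≡ Y * Y + (N * Y - Z)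
    second-moment = begin
      (∑[ h ∈ vectors n ] y h * y h)
        ≡⟨ ∑-cong (vectors n) (λ h → ∑-*-∑ I I _ _) ⟩
      (∑[ h ∈ vectors n ] ∑[ i ∈ I ] ∑[ j ∈ I ] (w (δ i) * α i h) * (w (δ j) * α j h))
        ≡⟨ trans (∑-swap (vectors n) I _) (∑-cong I λ i → ∑-swap (vectors n) I _) ⟩
      (∑[ i ∈ I ] ∑[ j ∈ I ] ∑[ h ∈ vectors n ] (w (δ i) * α i h) * (w (δ j) * α j h))
        ≡⟨ ∑-cong I (λ i → ∑-cong I (entry i)) ⟩
      (∑[ i ∈ I ] ∑[ j ∈ I ] (w (δ i) * f i) * (w (δ j) * f j) + 𝟙 (i Fin.≟ j) * g i j)
        ≡⟨ trans (∑-cong I (λ i → ∑-+ I _ _)) (∑-+ I _ _) ⟩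
      (∑[ i ∈ I ] ∑[ j ∈ I ] (w (δ i) * f i) * (w (δ j) * f j)) + (∑[ i ∈ I ] ∑[ j ∈ I ] 𝟙 (i Fin.≟ j) * g i j)
        ≡⟨ cong₂ _+_ (trans (sym (∑-*-∑ I I _ _)) (cong₂ _*_ Y-indexed Y-indexed)) (∑-cong I (λ i → ∑-δ i (g i))) ⟩
      Y * Y + (∑[ i ∈ I ] g i i)
        ≡⟨ cong (Y * Y +_) diagonal ⟩
      Y * Y + (N * Y - Z) ∎
      where
      g : ∀ i j → ℤ
      g i j = (w (δ i) * w (δ j)) * (N * f j - f j * f j)

      entry : ∀ i j → (∑[ h ∈ vectors n ] (w (δ i) * α i h) * (w (δ j) * α j h)) ≡
                      (w (δ i) * f i) * (w (δ j) * f j) + 𝟙 (i Fin.≟ j) * g i j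
      entry i j = begin
        (∑[ h ∈ vectors n ] (w (δ i) * α i h) * (w (δ j) * α j h))
          ≡⟨ ∑-cong (vectors n) (λ h → rearrange₁ (w (δ i)) (α i h) (w (δ j)) (α j h)) ⟩
        (∑[ h ∈ vectors n ] (w (δ i) * w (δ j)) * (α i h * α j h))
          ≡⟨ ∑-*ˡ (vectors n) (w (δ i) * w (δ j)) _ ⟩
        (w (δ i) * w (δ j)) * (∑[ h ∈ vectors n ] α i h * α j h)
          ≡⟨ cong ((w (δ i) * w (δ j)) *_) (∑-α*α i j) ⟩
        (w (δ i) * w (δ j)) * (f i * f j + 𝟙 (i Fin.≟ j) * (N * f j - f j * f j))
          ≡⟨ rearrange₂ (w (δ i)) (w (δ j)) (f i) (f j) (𝟙 (i Fin.≟ j)) (N * f j - f j * f j) ⟩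
        (w (δ i) * f i) * (w (δ j) * f j) + 𝟙 (i Fin.≟ j) * g i j ∎
        where
        rearrange₁ : ∀ a b c d → (a * b) * (c * d) ≡ (a * c) * (b * d)
        rearrange₁ = solve-∀
        rearrange₂ : ∀ a b c d e x → (a * b) * (c * d + e * x) ≡ (a * c) * (b * d) + e * ((a * b) * x)
        rearrange₂ = solve-∀

      diagonal : (∑[ i ∈ I ] g i i) ≡ N * Y - Z
      diagonal = begin
        (∑[ i ∈ I ] g i i)
          ≡⟨ ∑-cong I (λ i → trans (cong (_* (N * f i - f i * f i)) (w-idem (δ i))) (rearrange (w (δ i)) N (f i))) ⟩
        (∑[ i ∈ I ] N * (w (δ i) * f i) + (- 1ℤ) * (w (δ i) * (f i * f i)))
          ≡⟨ trans (∑-+ I _ _) (cong₂ _+_ (∑-*ˡ I N _) (∑-*ˡ I (- 1ℤ) _)) ⟩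
        N * (∑[ i ∈ I ] w (δ i) * f i) + (- 1ℤ) * (∑[ i ∈ I ] w (δ i) * (f i * f i))
          ≡⟨ cong₂ _+_ (cong (N *_) Y-indexed)
               (trans (cong (- 1ℤ *_) (∑-lookup P (λ S → w (dim S) * (codim-card (dim S) * codim-card (dim S))))) (-1*i≡-i Z)) ⟩
        N * Y - Z ∎
        where
        rearrange : ∀ a b c → a * (b * c - c * c) ≡ b * (a * c) + (- 1ℤ) * (a * (c * c))
        rearrange = solve-∀

    y-zero : ∀ {h} → IsZero h → y h ≡ y₀
    y-zero {h} h≈0 = trans
      (∑-cong I λ i → cong (w (δ i) *_) (𝟙-yes (annihilates? h _) (isZero⇒annihilates h≈0 (basis (U i)))))
      (∑-lookup P (λ S → w (dim S) * 1ℤ))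

    moment-inequality : 0ℤ ≤ (Y * Y + (N * Y - Z)) + (- pos 3) * (N * Y) + pos 2 * (N * N)
                             - (y₀ * y₀ - pos 3 * y₀ + pos 2)
    moment-inequality = subst (0ℤ ≤_) total (∑-nonneg (vectors n) nonneg)
      where
      c : ℤ
      c = y₀ * y₀ - pos 3 * y₀ + pos 2

      term : V F n → ℤ
      -- Here `c` is the value of (y - 1)(y - 2) at the zero functional. The indicator subtracts it
      -- there, so a sum over all vectors becomes one over the nonzero ones. Differences are written
      -- as sums of multiples, ready for linearity.
      term h = (y h * y h + (- pos 3) * y h) + (pos 2 * 1ℤ + (- c) * 𝟙 (isZero? h))

      nonneg : ∀ h → 0ℤ ≤ term h
      nonneg h with isZero? h
      ... | yes h≈0 rewrite y-zero h≈0 = ≤-reflexive (sym (vanish y₀))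
        where
        vanish : ∀ y → (y * y + (- pos 3) * y) + (pos 2 * 1ℤ + (- (y * y - pos 3 * y + pos 2)) * 1ℤ) ≡ 0ℤ
        vanish = solve-∀
      ... | no _ = subst (0ℤ ≤_) (expand (y h) c) ([y-1][y-2]≥0 (y h))
        where
        expand : ∀ y c → y * y - pos 3 * y + pos 2 ≡ (y * y + (- pos 3) * y) + (pos 2 * 1ℤ + (- c) * 0ℤ)
        expand = solve-∀

      total : ∑ (vectors n) term ≡ (Y * Y + (N * Y - Z)) + (- pos 3) * (N * Y) + pos 2 * (N * N) - c
      total = begin
        ∑ (vectors n) term
          ≡⟨ trans (∑-+ (vectors n) _ _) (cong₂ _+_ (∑-+ (vectors n) _ _) (∑-+ (vectors n) _ _)) ⟩
        ((∑[ h ∈ vectors n ] y h * y h) + (∑[ h ∈ vectors n ] (- pos 3) * y h)) +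
        ((∑[ h ∈ vectors n ] pos 2 * 1ℤ) + (∑[ h ∈ vectors n ] (- c) * 𝟙 (isZero? h)))
          ≡⟨ cong₂ _+_
               (cong₂ _+_ second-moment (trans (∑-*ˡ (vectors n) (- pos 3) y) (cong (- pos 3 *_) first-moment)))
               (cong₂ _+_ (trans (∑-*ˡ (vectors n) (pos 2) _) (cong (pos 2 *_) (trans (∑-1-vectors n) q^n≡N*N)))
                          (trans (∑-*ˡ (vectors n) (- c) _) (cong (- c *_) (∑-isZero n)))) ⟩
        ((Y * Y + (N * Y - Z)) + (- pos 3) * (N * Y)) + (pos 2 * (N * N) + (- c) * 1ℤ)
          ≡⟨ rearrange ((Y * Y + (N * Y - Z)) + (- pos 3) * (N * Y)) (pos 2 * (N * N)) c ⟩
        (Y * Y + (N * Y - Z)) + (- pos 3) * (N * Y) + pos 2 * (N * N) - c ∎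
        where
        rearrange : ∀ a b c → a + (b + (- c) * 1ℤ) ≡ a + b - c
        rearrange = solve-∀

-- The moment inequality for the dimensions t and d

module TwoDimensions {q : ℕ} (F : FiniteField q) (t : ℕ) (P : List (Subspace F (2 ℕ.* t)))
  (partition : IsVSPartition F P) (dim≤t : All (λ S → dim S ℕ.≤ t) P) (d : ℕ) (d<t : d ℕ.< t) where

  open import Data.Integer using (ℤ; _+_; _*_; _-_; -_; 0ℤ; 1ℤ; _≤_) renaming (+_ to pos)
  open import Data.Integer.Properties
  open import Data.Integer.Tactic.RingSolver using (solve-∀)
  open Summation
  open SecondMoment F t P partition dim≤t using (N; codim-card; module Weighted)
  open ≡-Reasoning

  w : ℕ → ℤ
  w k = 𝟙 (k ℕ.≟ t) + 𝟙 (k ℕ.≟ d)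

  -- The two conditions exclude each other because d < t, so the cross term of the square vanishes.
  w-idem : ∀ k → w k * w k ≡ w k
  w-idem k = begin
    (x + y) * (x + y)                    ≡⟨ expand x y ⟩
    (x * x + y * y) + pos 2 * (x * y)    ≡⟨ cong₂ _+_ (cong₂ _+_ (𝟙-idem (k ℕ.≟ t)) (𝟙-idem (k ℕ.≟ d))) (cong (pos 2 *_) x*y≡0) ⟩
    (x + y) + 0ℤ                         ≡⟨ +-identityʳ _ ⟩
    x + y                                ∎
    where
    x = 𝟙 (k ℕ.≟ t)
    y = 𝟙 (k ℕ.≟ d)

    expand : ∀ x y → (x + y) * (x + y) ≡ (x * x + y * y) + pos 2 * (x * y)
    expand = solve-∀

    x*y≡0 : x * y ≡ 0ℤ
    x*y≡0 = trans (𝟙-× (k ℕ.≟ t) (k ℕ.≟ d))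
      (𝟙-no ((k ℕ.≟ t) ×-dec (k ℕ.≟ d)) λ (k≡t , k≡d) → ℕ.<⇒≢ d<t (trans (sym k≡d) k≡t))

  open Weighted w w-idem

  ∑-weighted : ∀ (g : ℕ → ℤ) →
    (∑[ S ∈ P ] w (dim S) * g (dim S)) ≡ pos (mult F P t) * g t + pos (mult F P d) * g d
  ∑-weighted g = begin
    (∑[ S ∈ P ] w (dim S) * g (dim S))
      ≡⟨ ∑-cong P (λ S → trans (*-distribʳ-+ (g (dim S)) (𝟙 (dim S ℕ.≟ t)) (𝟙 (dim S ℕ.≟ d)))
           (cong₂ _+_ (𝟙-*-cong (dim S ℕ.≟ t) (cong g)) (𝟙-*-cong (dim S ℕ.≟ d) (cong g)))) ⟩
    (∑[ S ∈ P ] 𝟙 (dim S ℕ.≟ t) * g t + 𝟙 (dim S ℕ.≟ d) * g d)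
      ≡⟨ trans (∑-+ P _ _) (cong₂ _+_ (∑-*ʳ P _ (g t)) (∑-*ʳ P _ (g d))) ⟩
    (∑[ S ∈ P ] 𝟙 (dim S ℕ.≟ t)) * g t + (∑[ S ∈ P ] 𝟙 (dim S ℕ.≟ d)) * g d
      ≡⟨ cong₂ (λ a b → a * g t + b * g d) (∑-𝟙-filter (λ S → dim S ℕ.≟ t) P) (∑-𝟙-filter (λ S → dim S ℕ.≟ d) P) ⟩
    pos (mult F P t) * g t + pos (mult F P d) * g d ∎

  private
    m Q : ℤ
    m = pos (mult F P d)
    Q = codim-card d

  -- The desired bound multiplied by 2 D with D = N - 1 - m (Q - 1): the factor 2 clears the ½ in R,
  -- and D clears its denominator. In `identity` the a² of `Y * Y` cancels against that of
  -- `y₀ * y₀`.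
  integer-bound : ∀ a → pos (mult F P t) ≡ pos (q ℕ.^ t ℕ.+ 1) - a →
    pos 2 * (m * (N - Q)) - m * (m - 1ℤ) * (Q * Q - 1ℤ) ≤ pos 2 * (a * (N - 1ℤ - m * (Q - 1ℤ)))
  integer-bound a mₜ≡ = 0≤i-j⇒j≤i (subst (0ℤ ≤_) rearranged moment-inequality)
    where
    mₜ : ℤ
    mₜ = N + 1ℤ - a

    sum-of : ∀ (g : ℕ → ℤ) {x} → g t ≡ x → (∑[ S ∈ P ] w (dim S) * g (dim S)) ≡ mₜ * x + m * g d
    sum-of g refl = trans (∑-weighted g)
      (cong (λ z → z * g t + m * g d) (trans mₜ≡ (cong (_- a) (pos-+ (q ℕ.^ t) 1))))

    codim-card-t : codim-card t ≡ 1ℤ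
    codim-card-t = cong (λ k → pos (q ℕ.^ k)) (ℕ.n∸n≡0 t)

    E : (Y Z y₀ : ℤ) → ℤ
    E Y Z y₀ = (Y * Y + (N * Y - Z)) + (- pos 3) * (N * Y) + pos 2 * (N * N) - (y₀ * y₀ - pos 3 * y₀ + pos 2)

    rearranged : E Y Z y₀ ≡ pos 2 * (a * (N - 1ℤ - m * (Q - 1ℤ))) - (pos 2 * (m * (N - Q)) - m * (m - 1ℤ) * (Q * Q - 1ℤ))
    rearranged = begin
      E Y Z y₀
        ≡⟨ cong₂ (λ Y Z → E Y Z y₀) (sum-of codim-card codim-card-t)
             (sum-of (λ k → codim-card k * codim-card k) (cong (λ x → x * x) codim-card-t)) ⟩
      E (mₜ * 1ℤ + m * Q) (mₜ * 1ℤ + m * (Q * Q)) y₀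
        ≡⟨ cong (E (mₜ * 1ℤ + m * Q) (mₜ * 1ℤ + m * (Q * Q))) (sum-of (λ _ → 1ℤ) refl) ⟩
      E (mₜ * 1ℤ + m * Q) (mₜ * 1ℤ + m * (Q * Q)) (mₜ * 1ℤ + m * 1ℤ)
        ≡⟨ identity N Q m a ⟩
      pos 2 * (a * (N - 1ℤ - m * (Q - 1ℤ))) - (pos 2 * (m * (N - Q)) - m * (m - 1ℤ) * (Q * Q - 1ℤ)) ∎
      where
      identity : ∀ N Q m a →
        (((N + 1ℤ - a) * 1ℤ + m * Q) * ((N + 1ℤ - a) * 1ℤ + m * Q) +
          (N * ((N + 1ℤ - a) * 1ℤ + m * Q) - ((N + 1ℤ - a) * 1ℤ + m * (Q * Q)))) +
        (- pos 3) * (N * ((N + 1ℤ - a) * 1ℤ + m * Q)) + pos 2 * (N * N) -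
        (((N + 1ℤ - a) * 1ℤ + m * 1ℤ) * ((N + 1ℤ - a) * 1ℤ + m * 1ℤ) - pos 3 * ((N + 1ℤ - a) * 1ℤ + m * 1ℤ) + pos 2)
        ≡ pos 2 * (a * (N - 1ℤ - m * (Q - 1ℤ))) - (pos 2 * (m * (N - Q)) - m * (m - 1ℤ) * (Q * Q - 1ℤ))
      identity = solve-∀

-- From the integer inequality to the rational bound

module RationalBound where

  open import Data.Integer as ℤ using (ℤ)
  import Data.Integer.Properties as ℤ
  open import Data.Integer.Tactic.RingSolver using (solve-∀)
  open import Data.Rational.Unnormalised as ℚᵘ using (mkℚᵘ; *≡*; *≤*; *<*)
  import Data.Rational.Unnormalised.Properties as ℚᵘ
  open import Data.Rational using (_+_; _*_; _-_; -_; _≤_; _<_; 0ℚ; 1ℚ; ½; positive; toℚᵘ; ≢-nonZero)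
  open import Data.Rational.Properties
  open import Data.Rational.Solver using (module +-*-Solver)
  open +-*-Solver using (solve; con; _:+_; _:*_; _:-_; _:=_)

  -- Normalisation by the gcd blocks computation with `x / 1` for a variable x, so arithmetic and
  -- order are transferred through unnormalised fractions. The `0` stands for the denominator 1.
  toℚᵘ-fromℤ : ∀ x → toℚᵘ (fromℤ x) ℚᵘ.≃ mkℚᵘ x 0
  toℚᵘ-fromℤ x = toℚᵘ-fromℚᵘ (mkℚᵘ x 0)

  fromℤ-* : ∀ x y → fromℤ (x ℤ.* y) ≡ fromℤ x * fromℤ y
  fromℤ-* x y = toℚᵘ-injective (begin
    toℚᵘ (fromℤ (x ℤ.* y))                ≈⟨ toℚᵘ-fromℤ (x ℤ.* y) ⟩
    mkℚᵘ (x ℤ.* y) 0                      ≈⟨ *≡* refl ⟩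
    mkℚᵘ x 0 ℚᵘ.* mkℚᵘ y 0                ≈⟨ ℚᵘ.*-cong (toℚᵘ-fromℤ x) (toℚᵘ-fromℤ y) ⟨
    toℚᵘ (fromℤ x) ℚᵘ.* toℚᵘ (fromℤ y)    ≈⟨ toℚᵘ-homo-* (fromℤ x) (fromℤ y) ⟨
    toℚᵘ (fromℤ x * fromℤ y)              ∎)
    where open import Relation.Binary.Reasoning.Setoid ℚᵘ.≃-setoid

  fromℤ-- : ∀ x y → fromℤ (x ℤ.- y) ≡ fromℤ x - fromℤ y
  fromℤ-- x y = toℚᵘ-injective (begin
    toℚᵘ (fromℤ (x ℤ.- y))                    ≈⟨ toℚᵘ-fromℤ (x ℤ.- y) ⟩
    mkℚᵘ (x ℤ.- y) 0                          ≈⟨ *≡* (cross x y) ⟩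
    mkℚᵘ x 0 ℚᵘ.- mkℚᵘ y 0                    ≈⟨ ℚᵘ.+-cong (toℚᵘ-fromℤ x) (ℚᵘ.-‿cong (toℚᵘ-fromℤ y)) ⟨
    toℚᵘ (fromℤ x) ℚᵘ.- toℚᵘ (fromℤ y)        ≈⟨ ℚᵘ.+-congʳ (toℚᵘ (fromℤ x)) (toℚᵘ-homo‿- (fromℤ y)) ⟨
    toℚᵘ (fromℤ x) ℚᵘ.+ toℚᵘ (- fromℤ y)      ≈⟨ toℚᵘ-homo-+ (fromℤ x) (- fromℤ y) ⟨
    toℚᵘ (fromℤ x - fromℤ y)                  ∎)
    where
    open import Relation.Binary.Reasoning.Setoid ℚᵘ.≃-setoid
    cross : ∀ x y → (x ℤ.- y) ℤ.* ℤ.1ℤ ≡ (x ℤ.* ℤ.1ℤ ℤ.+ (ℤ.- y) ℤ.* ℤ.1ℤ) ℤ.* ℤ.1ℤ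
    cross = solve-∀

  fromℤ-mono-≤ : ∀ {x y} → x ℤ.≤ y → fromℤ x ≤ fromℤ y
  fromℤ-mono-≤ {x} {y} x≤y = toℚᵘ-cancel-≤
    (ℚᵘ.≤-respˡ-≃ (ℚᵘ.≃-sym (toℚᵘ-fromℤ x)) (ℚᵘ.≤-respʳ-≃ (ℚᵘ.≃-sym (toℚᵘ-fromℤ y)) (*≤* (ℤ.*-monoʳ-≤-nonNeg ℤ.1ℤ x≤y))))

  fromℤ-mono-< : ∀ {x y} → x ℤ.< y → fromℤ x < fromℤ y
  fromℤ-mono-< {x} {y} x<y = toℚᵘ-cancel-<
    (ℚᵘ.<-respˡ-≃ (ℚᵘ.≃-sym (toℚᵘ-fromℤ x)) (ℚᵘ.<-respʳ-≃ (ℚᵘ.≃-sym (toℚᵘ-fromℤ y)) (*<* (ℤ.*-monoʳ-<-pos ℤ.1ℤ x<y))))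

  -- Both quotients of the theorem, the bound on m_d and the one in R, are accessed only through
  -- this cancellation, where the default value of `÷₀` is excluded.
  ÷₀-* : ∀ x y → y ≢ 0ℚ → (x ÷₀ y) * y ≡ x
  ÷₀-* x y y≢0 with y ≟ 0ℚ
  ... | yes y≡0 = contradiction y≡0 y≢0
  ... | no  y≢0 = trans (*-assoc x _ y) (trans (cong (x *_) (*-inverseˡ y {{≢-nonZero y≢0}})) (*-identityʳ x))

  <⇒0<- : ∀ {x y} → x < y → 0ℚ < y - x
  <⇒0<- {x} {y} x<y = subst (_< y - x) (+-inverseʳ x) (+-monoˡ-< (- x) x<y)

  >⇒≢ : ∀ {x} → 0ℚ < x → x ≢ 0ℚ
  >⇒≢ 0<x x≡0 = <⇒≢ 0<x (sym x≡0)

  rational-bound : ∀ (N Q m a : ℤ) → ℤ.1ℤ ℤ.< Q →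
    let N′ = fromℤ N; Q′ = fromℤ Q; m′ = fromℤ m in
    m′ < (N′ - 1ℚ) ÷₀ (Q′ - 1ℚ) →
    ℤ.+ 2 ℤ.* (m ℤ.* (N ℤ.- Q)) ℤ.- m ℤ.* (m ℤ.- ℤ.1ℤ) ℤ.* (Q ℤ.* Q ℤ.- ℤ.1ℤ)
      ℤ.≤ ℤ.+ 2 ℤ.* (a ℤ.* (N ℤ.- ℤ.1ℤ ℤ.- m ℤ.* (Q ℤ.- ℤ.1ℤ))) →
    m′ - (m′ * (m′ - 1ℚ)) * ((½ * (fromℤ (Q ℤ.* Q) - 1ℚ) + 1ℚ - Q′) ÷₀ (N′ - 1ℚ - m′ * (Q′ - 1ℚ))) ≤ fromℤ a
  rational-bound N Q m a 1<Q m<bound bound = *-cancelʳ-≤-pos D {{positive D>0}} (begin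
    (m′ - (m′ * (m′ - 1ℚ)) * r) * D                     ≡⟨ expand m′ (m′ * (m′ - 1ℚ)) r D ⟩
    m′ * D - (m′ * (m′ - 1ℚ)) * (r * D)                 ≡⟨ cong (λ z → m′ * D - (m′ * (m′ - 1ℚ)) * z) (÷₀-* _ D (>⇒≢ D>0)) ⟩
    m′ * D - (m′ * (m′ - 1ℚ)) * (½ * (fromℤ (Q ℤ.* Q) - 1ℚ) + 1ℚ - Q′)
      ≡⟨ cong (λ z → m′ * D - (m′ * (m′ - 1ℚ)) * (½ * (z - 1ℚ) + 1ℚ - Q′)) (fromℤ-* Q Q) ⟩
    -- The summand 1 - Q in the numerator of R reduces the term - m² (Q - 1) of m D to - m (Q - 1),
    -- which turns m (N - 1) into m (N - Q).
    m′ * D - (m′ * (m′ - 1ℚ)) * (½ * (Q′ * Q′ - 1ℚ) + 1ℚ - Q′)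
      ≡⟨ collect N′ Q′ m′ ⟩
    ½ * (fromℤ (ℤ.+ 2) * (m′ * (N′ - Q′)) - m′ * (m′ - 1ℚ) * (Q′ * Q′ - 1ℚ))
      ≤⟨ *-monoˡ-≤-nonNeg ½ (subst₂ _≤_ lhs rhs (fromℤ-mono-≤ bound)) ⟩
    ½ * (fromℤ (ℤ.+ 2) * (fromℤ a * D))                 ≡⟨ halve (fromℤ a * D) ⟩
    fromℤ a * D                                         ∎)
    where
    open ≤-Reasoning
    N′ = fromℤ N
    Q′ = fromℤ Q
    m′ = fromℤ m
    D  = N′ - 1ℚ - m′ * (Q′ - 1ℚ)
    r  = (½ * (fromℤ (Q ℤ.* Q) - 1ℚ) + 1ℚ - Q′) ÷₀ D

    0<Q-1 : 0ℚ < Q′ - 1ℚ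
    0<Q-1 = <⇒0<- (fromℤ-mono-< 1<Q)

    -- The assumption on m multiplied by Q - 1 > 0. It justifies cancelling `D` in the inequality
    -- and shows that the quotient in R is a genuine one.
    D>0 : 0ℚ < D
    D>0 = <⇒0<- (subst (m′ * (Q′ - 1ℚ) <_) (÷₀-* _ (Q′ - 1ℚ) (>⇒≢ 0<Q-1))
                  (*-monoˡ-<-pos (Q′ - 1ℚ) {{positive 0<Q-1}} m<bound))

    expand : ∀ x y r D → (x - y * r) * D ≡ x * D - y * (r * D)
    expand = solve 4 (λ x y r D → (x :- y :* r) :* D := x :* D :- y :* (r :* D)) refl

    collect : ∀ N Q m → m * (N - 1ℚ - m * (Q - 1ℚ)) - (m * (m - 1ℚ)) * (½ * (Q * Q - 1ℚ) + 1ℚ - Q) ≡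
              ½ * (fromℤ (ℤ.+ 2) * (m * (N - Q)) - m * (m - 1ℚ) * (Q * Q - 1ℚ))
    collect = solve 3 (λ N Q m →
      m :* (N :- con 1ℚ :- m :* (Q :- con 1ℚ)) :- (m :* (m :- con 1ℚ)) :* (con ½ :* (Q :* Q :- con 1ℚ) :+ con 1ℚ :- Q) :=
      con ½ :* (con (fromℤ (ℤ.+ 2)) :* (m :* (N :- Q)) :- m :* (m :- con 1ℚ) :* (Q :* Q :- con 1ℚ))) refl

    halve : ∀ x → ½ * (fromℤ (ℤ.+ 2) * x) ≡ x
    halve = solve 1 (λ x → con ½ :* (con (fromℤ (ℤ.+ 2)) :* x) := x) refl

    lhs : fromℤ (ℤ.+ 2 ℤ.* (m ℤ.* (N ℤ.- Q)) ℤ.- m ℤ.* (m ℤ.- ℤ.1ℤ) ℤ.* (Q ℤ.* Q ℤ.- ℤ.1ℤ)) ≡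
          fromℤ (ℤ.+ 2) * (m′ * (N′ - Q′)) - m′ * (m′ - 1ℚ) * (Q′ * Q′ - 1ℚ)
    lhs rewrite fromℤ-- (ℤ.+ 2 ℤ.* (m ℤ.* (N ℤ.- Q))) (m ℤ.* (m ℤ.- ℤ.1ℤ) ℤ.* (Q ℤ.* Q ℤ.- ℤ.1ℤ))
              | fromℤ-* (ℤ.+ 2) (m ℤ.* (N ℤ.- Q)) | fromℤ-* m (N ℤ.- Q) | fromℤ-- N Q
              | fromℤ-* (m ℤ.* (m ℤ.- ℤ.1ℤ)) (Q ℤ.* Q ℤ.- ℤ.1ℤ) | fromℤ-* m (m ℤ.- ℤ.1ℤ) | fromℤ-- m ℤ.1ℤ
              | fromℤ-- (Q ℤ.* Q) ℤ.1ℤ | fromℤ-* Q Q = refl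

    rhs : fromℤ (ℤ.+ 2 ℤ.* (a ℤ.* (N ℤ.- ℤ.1ℤ ℤ.- m ℤ.* (Q ℤ.- ℤ.1ℤ)))) ≡ fromℤ (ℤ.+ 2) * (fromℤ a * D)
    rhs rewrite fromℤ-* (ℤ.+ 2) (a ℤ.* (N ℤ.- ℤ.1ℤ ℤ.- m ℤ.* (Q ℤ.- ℤ.1ℤ)))
              | fromℤ-* a (N ℤ.- ℤ.1ℤ ℤ.- m ℤ.* (Q ℤ.- ℤ.1ℤ)) | fromℤ-- (N ℤ.- ℤ.1ℤ) (m ℤ.* (Q ℤ.- ℤ.1ℤ))
              | fromℤ-- N ℤ.1ℤ | fromℤ-* m (Q ℤ.- ℤ.1ℤ) | fromℤ-- Q ℤ.1ℤ = refl

-- The bound in terms of powers of q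

open import Data.Nat using (ℕ; _≤_; _<_; _*_; _+_; _^_; _∸_)
open import Data.Integer as ℤ using (ℤ; +_)
open import Data.Rational as ℚ using (ℚ; 1ℚ)
import Data.Integer.Properties as ℤ

theorem11 : (q : ℕ) → IsPrimePower q → (F : FiniteField q) →
    (t : ℕ) → 2 ≤ t →
    (P : List (Subspace F (2 * t))) → IsVSPartition F P →
    All (λ S → dim S ≤ t) P →
    (a : ℤ) → + mult F P t ≡ + (q ^ t + 1) ℤ.- a →
    (d : ℕ) → 1 ≤ d → d < t → 0 < mult F P d →
    fromℕ (mult F P d) ℚ.< ((fromℕ (q ^ t) ℚ.- 1ℚ) ÷₀ (fromℕ (q ^ (t ∸ d)) ℚ.- 1ℚ)) →
    fromℕ (mult F P d) ℚ.- Rq q t d (mult F P d) ℚ.≤ fromℤ a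
theorem11 q _ F t _ P partition dim≤t a mₜ≡ d _ d<t _ m<bound =
  subst (λ z → m ℚ.- (m ℚ.* (m ℚ.- 1ℚ)) ℚ.* ((ℚ.½ ℚ.* (fromℤ z ℚ.- 1ℚ) ℚ.+ 1ℚ ℚ.- Q) ÷₀ D) ℚ.≤ fromℤ a) Q*Q≡
    (RationalBound.rational-bound (+ (q ^ t)) (+ (q ^ (t ∸ d))) (+ mult F P d) a (ℤ.+<+ 1<Q) m<bound
      (TwoDimensions.integer-bound F t P partition dim≤t d d<t a mₜ≡))
  where
  m = fromℕ (mult F P d)
  Q = fromℕ (q ^ (t ∸ d))
  D = fromℕ (q ^ t) ℚ.- 1ℚ ℚ.- m ℚ.* (Q ℚ.- 1ℚ)

  -- This uses d < t; it makes Q - 1 nonzero, so the quotient bounding m_d is not the default value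
  -- 0.
  1<Q : 1 < q ^ (t ∸ d)
  1<Q = ℕ.^-monoʳ-< q (LinearAlgebra.1<q F) (ℕ.m<n⇒0<n∸m d<t)

  Q*Q≡ : + (q ^ (t ∸ d)) ℤ.* + (q ^ (t ∸ d)) ≡ + (q ^ (2 * t ∸ 2 * d))
  Q*Q≡ = begin
    + (q ^ (t ∸ d)) ℤ.* + (q ^ (t ∸ d))   ≡⟨ ℤ.pos-* (q ^ (t ∸ d)) (q ^ (t ∸ d)) ⟨
    + (q ^ (t ∸ d) * q ^ (t ∸ d))         ≡⟨ cong +_ (ℕ.^-distribˡ-+-* q (t ∸ d) (t ∸ d)) ⟨
    + (q ^ ((t ∸ d) + (t ∸ d)))           ≡⟨ cong (λ k → + (q ^ ((t ∸ d) + k))) (ℕ.+-identityʳ (t ∸ d)) ⟨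
    + (q ^ (2 * (t ∸ d)))                 ≡⟨ cong (λ k → + (q ^ k)) (ℕ.*-distribˡ-∸ 2 t d) ⟩
    + (q ^ (2 * t ∸ 2 * d))               ∎
    where open ≡-Reasoning
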